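{- Let $\mathcal{O}^*(f(n))$ be the running time of an algorithm that enumerates all maximal independent sets of a given graph with $n$ vertices. Then INDEPENDENT CUTSET, on a connected input graph $G$ with $n$ vertices and maximum degree $\Delta$, can be solved in $\mathcal{O}^*(2^k\cdot f(k))$ time, where $k = n-\Delta$.
   Context: All graphs are finite, simple, loopless and undirected. A set $S$ of vertices of a graph $G$ is a cutset of $G$ if $G-S$ is disconnected; it is an independent set if its vertices are pairwise nonadjacent. An independent cutset of $G$ is a set of vertices that is both a cutset and an independent set of $G$. INDEPENDENT CUTSET is the decision problem: given a connected graph $G$, does $G$ have an independent cutset? The notation $\mathcal{O}^*$ is the $\mathcal{O}$-notation with factors polynomial in the input size suppressed. -}

module Defs where

open import Data.Bool.Base using (Bool; true; false; T)
open import Data.Fin.Base using (Fin)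
open import Data.Fin.Subset using (Subset; _∈_; _∉_; _⊆_; ∣_∣)
open import Data.List.Base using (List; []; _∷_; map; allFin)
open import Data.List.Extrema.Nat using (max)
import Data.List.Membership.Propositional as List
open import Data.Nat.Base using (ℕ; suc; _+_; _*_; _^_; _≤_)
open import Data.Product.Base using (Σ-syntax; ∃-syntax; _×_; _,_)
open import Data.Refinement.Base using (Refinement-syntax; value)
open import Data.Sum.Base using (_⊎_)
import Data.Vec.Base as Vec
open import Function.Bundles using (_⇔_)
open import Relation.Binary.Construct.Closure.ReflexiveTransitive using (Star)
open import Relation.Binary.PropositionalEquality.Core using (_≡_)
open import Relation.Nullary.Negation.Core using (¬_)

------------------------------------------------------------------------
-- Graphs

record Graph (V : Set) : Set where
  field
    adj : V → V → Bool

  Adj : V → V → Set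
  Adj u v = T (adj u v)

  field
    symmetric : ∀ {u v} → Adj u v → Adj v u
    loopless  : ∀ {v} → ¬ Adj v v

open Graph public

-- `Star (Adj G) u v` is the type of walks from u to v. The graph without
-- vertices counts as connected, so deleting all vertices does not
-- disconnect a graph.

Connected : {V : Set} → Graph V → Set
Connected G = ∀ u v → Star (Adj G) u v

Disconnected : {V : Set} → Graph V → Set
Disconnected G = ¬ Connected G

module _ {n : ℕ} where

  infixl 6 _-_

  _-_ : Graph (Fin n) → (S : Subset n) → Graph [ v ∈ Fin n ∣ v ∉ S ]
  G - S = record
    { adj       = λ u v → adj G (value u) (value v)
    ; symmetric = symmetric G
    ; loopless  = loopless G
    }

  Cutset : Graph (Fin n) → Subset n → Set
  Cutset G S = Disconnected (G - S)

  Independent : Graph (Fin n) → Subset n → Set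
  Independent G S = ∀ {u v} → u ∈ S → v ∈ S → ¬ Adj G u v

  MaximalIndependent : Graph (Fin n) → Subset n → Set
  MaximalIndependent G S =
    Independent G S × (∀ T → Independent G T → S ⊆ T → T ⊆ S)

  HasIndependentCutset : Graph (Fin n) → Set
  HasIndependentCutset G = ∃[ S ] Cutset G S × Independent G S

  neighbourhood : Graph (Fin n) → Fin n → Subset n
  neighbourhood G v = Vec.tabulate (adj G v)

  degree : Graph (Fin n) → Fin n → ℕ
  degree G v = ∣ neighbourhood G v ∣

  maxDegree : Graph (Fin n) → ℕ
  maxDegree G = max 0 (map (degree G) (allFin n))

------------------------------------------------------------------------
-- Model of computation
--
-- Programs are WHILE programs over binary trees (Lisp data), in the style
-- of N. D. Jones, "Computability and Complexity from a Programming
-- Perspective", written as transformers of a single tree; a store with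
-- several variables is a tuple of trees. Every construct costs one step
-- in addition to the cost of its parts. This is realistic because trees
-- are kept as pointers to immutable, possibly shared, cons cells, so that
-- copying, projecting and pairing take constant time. Accordingly the
-- only test on data is whether a tree is nil; there is no unit-cost
-- comparison of whole trees.

infixr 5 _∙_

data Tree : Set where
  nil : Tree
  _∙_ : Tree → Tree → Tree

size : Tree → ℕ
size nil     = 1
size (x ∙ y) = suc (size x + size y)

infixr 4 _⨾_

data Program : Set where
  skip null hd tl : Program
  cons            : Program → Program → Program
  _⨾_             : Program → Program → Program
  if_then_else_   : Program → Program → Program → Program
  while_loop_     : Program → Program → Program

infix 3 _$_⇓_in-time_

-- `p $ x ⇓ y in-time t`: on input x, program p halts with output y after
-- exactly t steps.

data _$_⇓_in-time_ : Program → Tree → Tree → ℕ → Set where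

  skip : ∀ {x} → skip $ x ⇓ x in-time 1

  null : ∀ {x} → null $ x ⇓ nil in-time 1

  hd-nil : hd $ nil ⇓ nil in-time 1
  hd-∙   : ∀ {x y} → hd $ x ∙ y ⇓ x in-time 1

  tl-nil : tl $ nil ⇓ nil in-time 1
  tl-∙   : ∀ {x y} → tl $ x ∙ y ⇓ y in-time 1

  cons : ∀ {p q x y z s t} →
         p $ x ⇓ y in-time s →
         q $ x ⇓ z in-time t →
         cons p q $ x ⇓ y ∙ z in-time suc (s + t)

  _⨾_ : ∀ {p q x y z s t} →
        p $ x ⇓ y in-time s →
        q $ y ⇓ z in-time t →
        p ⨾ q $ x ⇓ z in-time suc (s + t)

  if-then : ∀ {b p q x y z w s t} →
            b $ x ⇓ y ∙ z in-time s →
            p $ x ⇓ w in-time t →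
            if b then p else q $ x ⇓ w in-time suc (s + t)

  if-else : ∀ {b p q x w s t} →
            b $ x ⇓ nil in-time s →
            q $ x ⇓ w in-time t →
            if b then p else q $ x ⇓ w in-time suc (s + t)

  while-stop : ∀ {b p x s} →
               b $ x ⇓ nil in-time s →
               while b loop p $ x ⇓ x in-time suc s

  while-step : ∀ {b p x y z x′ w r s t} →
               b $ x ⇓ y ∙ z in-time r →
               p $ x ⇓ x′ in-time s →
               while b loop p $ x′ ⇓ w in-time t →
               while b loop p $ x ⇓ w in-time suc (r + s + t)

------------------------------------------------------------------------
-- Problems and running times

encodeBool : Bool → Tree
encodeBool false = nil
encodeBool true  = nil ∙ nil

encodeList : {A : Set} → (A → Tree) → List A → Tree
encodeList enc []       = nil
encodeList enc (x ∷ xs) = enc x ∙ encodeList enc xs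

-- Characteristic vector.

encodeSubset : ∀ {n} → Subset n → Tree
encodeSubset S = encodeList encodeBool (Vec.toList S)

-- Adjacency matrix, as the list of its rows.

encodeGraph : ∀ {n} → Graph (Fin n) → Tree
encodeGraph {n} G = encodeList encodeSubset (map (neighbourhood G) (allFin n))

record Problem : Set₁ where
  field
    Instance : Set
    encode   : Instance → Tree
    Correct  : Instance → Tree → Set

-- `p solves P in-O* g`: on every instance i of P, the program p halts
-- with a correct output within c · |i|^d · g i steps, where |i| is the
-- size of the encoding of i and the constants c and d do not depend on i.

infix 3 _solves_in-O*_

_solves_in-O*_ : Program → (P : Problem) → (Problem.Instance P → ℕ) → Set
p solves P in-O* g =
  ∃[ c ] ∃[ d ] ((i : Instance) →
    ∃[ y ] ∃[ t ] (p $ encode i ⇓ y in-time t)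
                × Correct i y
                × t ≤ c * size (encode i) ^ d * g i)
  where open Problem P

-- The output is a list of exactly the maximal independent sets, in any
-- order; repetitions are tolerated.

ENUMERATE-MAXIMAL-INDEPENDENT-SETS : Problem
ENUMERATE-MAXIMAL-INDEPENDENT-SETS = record
  { Instance = Σ[ n ∈ ℕ ] Graph (Fin n)
  ; encode   = λ (n , G) → encodeGraph G
  ; Correct  = λ (n , G) y →
      ∃[ Ss ] y ≡ encodeList encodeSubset Ss
            × (∀ S → S List.∈ Ss ⇔ MaximalIndependent G S)
  }

INDEPENDENT-CUTSET : Problem
INDEPENDENT-CUTSET = record
  { Instance = Σ[ n ∈ ℕ ] Σ[ G ∈ Graph (Fin n) ] Connected G
  ; encode   = λ (n , G , _) → encodeGraph G
  ; Correct  = λ (n , G , _) y →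
      (y ≡ encodeBool true  ×   HasIndependentCutset G) ⊎
      (y ≡ encodeBool false × ¬ HasIndependentCutset G)
  }

-- Let v be a vertex of maximum degree; it has k - 1 non-neighbours other than
-- itself. If an independent cutset S contains v, then S avoids the
-- neighbourhood of v. If it does not, let X be the set of vertices outside S
-- that v does not reach in G - S. Then X also avoids the neighbourhood of v,
-- and the boundary of X is contained in S and separates X from v, so that it is
-- an independent cutset as well. Hence it suffices to test, in polynomial time
-- each, the 2 ^ k subsets X of the complement of the neighbourhood of v and
-- their boundaries. As every computation takes at least one step, f is
-- positive, and 2 ^ k tests are within the bound without any enumeration of
-- maximal independent sets.

module Submission where

open import Defs
open import Data.Bool.Base using (Bool; true; false; not; _∧_; _∨_; T)
  renaming (if_then_else_ to choose)
open import Data.Bool.ListAction using (any)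
import Data.Bool.Properties as Bool
open import Data.Fin.Base using (Fin; zero; suc)
open import Data.Fin.Properties using (any?)
open import Data.Fin.Subset using (Subset; _∈_; _∉_; _⊆_; Nonempty; ∣_∣; _∪_; _∩_; ∁; ⁅_⁆)
  renaming (⊥ to ∅)
open import Data.Fin.Subset.Properties
open import Data.Irrelevant using ([_])
open import Data.List.Base as List using (List; []; _∷_; foldl; length; _ʳ++_; allFin)
open import Data.List.Extrema.Nat using (max≤v⁺)
open import Data.List.Membership.Propositional renaming (_∈_ to _∈ₗ_) using (find; lose)
open import Data.List.Membership.Propositional.Properties using (∈-map⁻)
import Data.List.Properties as List
open import Data.List.Relation.Binary.Permutation.Propositional.Properties
  using (↭-reverse) renaming (map⁺ to ↭-map⁺)
open import Data.List.Relation.Unary.All as All using (All; []; _∷_)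
import Data.List.Relation.Unary.All.Properties as All
open import Data.List.Relation.Unary.Any using (here; there)
open import Data.List.Relation.Unary.Any.Properties using (any⁺; any⁻)
open import Data.Nat.Base
open import Data.Nat.GeneralisedArithmetic using (fold)
open import Data.Nat.ListAction using (product)
open import Data.Nat.ListAction.Properties using (product-↭)
open import Data.Nat.Properties
open import Data.Nat.Tactic.RingSolver using (solve-∀)
open import Data.Product.Base using (∃-syntax; Σ-syntax; _×_; _,_; proj₁; proj₂; swap)
open import Data.Refinement.Base using (Refinement-syntax; _,_; value)
open import Data.Sum.Base using (_⊎_; inj₁; inj₂)
open import Data.Unit.Base using (⊤)
open import Data.Vec.Base as Vec using (Vec; []; _∷_; toList; zipWith)
import Data.Vec.Properties as Vec
open import Function.Base using (_∘_; flip)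
open import Relation.Binary.Construct.Closure.ReflexiveTransitive
  using (Star; ε; _◅_; _◅◅_; reverse)
open import Relation.Binary.PropositionalEquality hiding ([_])
open import Relation.Nullary.Decidable
  using (yes; no; _because_; map′; proof; ¬?; _×-dec_; decidable-stable)
open import Relation.Nullary.Negation using (¬_; contradiction)
open import Relation.Nullary.Recomputable using (¬-recompute)
open import Relation.Nullary.Reflects
  using (Reflects; ofʸ; ofⁿ; fromEquivalence; ¬-reflects; _×-reflects_; _⊎-reflects_)

private
  variable
    X Y Z : Set
    m n : ℕ
    p q r : Program
    x x′ y z w : Tree
    s t u : ℕ

-- Running times of programs

infix 3 _$_⇓_within_

_$_⇓_within_ : Program → Tree → Tree → ℕ → Set
p $ x ⇓ y within t = ∃[ s ] (p $ x ⇓ y in-time s) × s ≤ t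

run-≤ : s ≤ t → p $ x ⇓ y within s → p $ x ⇓ y within t
run-≤ s≤t (r , d , r≤s) = r , d , ≤-trans r≤s s≤t

run : p $ x ⇓ y in-time t → p $ x ⇓ y within t
run d = _ , d , ≤-refl

run-⨾ : p $ x ⇓ y within s → q $ y ⇓ z within t → p ⨾ q $ x ⇓ z within suc (s + t)
run-⨾ (_ , d , i) (_ , e , j) = _ , (d ⨾ e) , s≤s (+-mono-≤ i j)

run-cons : p $ x ⇓ y within s → q $ x ⇓ z within t → cons p q $ x ⇓ y ∙ z within suc (s + t)
run-cons (_ , d , i) (_ , e , j) = _ , cons d e , s≤s (+-mono-≤ i j)

-- Both branches are charged, so that the bound does not depend on `b`.
run-if : ∀ b → p $ x ⇓ encodeBool b within s →
         (q $ x ⇓ y within t) → (r $ x ⇓ z within u) →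
         if p then q else r $ x ⇓ choose b y z within suc (s + (t + u))
run-if true  (_ , d , i) (_ , e , j) _ = _ , if-then d e , s≤s (+-mono-≤ i (≤-trans j (m≤m+n _ _)))
run-if false (_ , d , i) _ (_ , e , j) = _ , if-else d e , s≤s (+-mono-≤ i (≤-trans j (m≤n+m _ _)))

run-while-step : p $ x ⇓ y ∙ z within s → q $ x ⇓ x′ within t → while p loop q $ x′ ⇓ w within u →
                 while p loop q $ x ⇓ w within suc (s + t + u)
run-while-step (_ , d , i) (_ , e , j) (_ , f , k) =
  _ , while-step d e f , s≤s (+-mono-≤ (+-mono-≤ i j) k)

-- A store `xs ∙ (b ∙ e)` holds the list to be traversed, the accumulator
-- and an environment; the step is run on `x ∙ (b ∙ e)`.

foldBody : Program → Program
foldBody step =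
  cons (hd ⨾ tl) (cons (cons (hd ⨾ hd) tl ⨾ step) (tl ⨾ tl))

foldProgram : Program → Program
foldProgram step = (while hd loop foldBody step) ⨾ tl ⨾ hd

-- `Inv` relates the entries still to come to the accumulator. It allows a single bound `T` for all
-- steps even when the cost of a step depends on an accumulator that grows, as in `run-enumerate`.
module _ (encX : X → Tree) (encY : Y → Tree) (e : Tree)
         (f : Y → X → Y) (step : Program) (T : ℕ)
         (Inv : List X → Y → Set)
         (run-step : ∀ x xs y → Inv (x ∷ xs) y →
            (step $ encX x ∙ encY y ∙ e ⇓ encY (f y x) within T) × Inv xs (f y x))
         where

  private
    run-while : ∀ xs y → Inv xs y →
      while hd loop foldBody step $ encodeList encX xs ∙ encY y ∙ e
        ⇓ nil ∙ encY (foldl f y xs) ∙ e within 2 + length xs * (16 + T)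
    run-while []       y i = _ , while-stop hd-∙ , ≤-refl
    run-while (x ∷ xs) y i with run-step x xs y i
    ... | run-x , i′ =
      -- Besides `T`, an iteration spends 16 steps on the loop test and on taking the store apart
      -- and rebuilding it.
      run-≤ (≤-reflexive (time T (length xs))) (run-while-step (run hd-∙)
        (run-cons (run-⨾ (run hd-∙) (run tl-∙))
          (run-cons (run-⨾ (run-cons (run-⨾ (run hd-∙) (run hd-∙)) (run tl-∙)) run-x)
            (run-⨾ (run tl-∙) (run tl-∙))))
        (run-while xs (f y x) i′))
      where
      time : ∀ T l → suc (1 + suc (3 + suc (suc (suc (3 + 1) + T) + 3)) + (2 + l * (16 + T)))
                     ≡ 2 + (16 + T + l * (16 + T))
      time = solve-∀

  run-fold : ∀ xs y → Inv xs y →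
    foldProgram step $ encodeList encX xs ∙ encY y ∙ e
      ⇓ encY (foldl f y xs) within 6 + length xs * (16 + T)
  run-fold xs y i =
    run-≤ (≤-reflexive (time (length xs * (16 + T))))
      (run-⨾ (run-while xs y i) (run-⨾ (run tl-∙) (run hd-∙)))
    where
    time : ∀ l → suc (2 + l + 3) ≡ 6 + l
    time = solve-∀

-- Polynomial-time functions on trees

-- With base `suc n`, which is positive, a larger exponent never lowers the bound, even at `n = 0`.
Polynomial : (ℕ → ℕ) → Set
Polynomial T = ∃[ c ] ∃[ d ] ∀ n → T n ≤ c * suc n ^ d

poly-const : ∀ c → Polynomial (λ _ → c)
poly-const c = c , 0 , λ _ → ≤-reflexive (sym (*-identityʳ c))

poly-n : Polynomial (λ n → n)
poly-n = 1 , 1 , λ n → ≤-trans (n≤1+n n) (≤-reflexive (sym (trans (*-identityˡ _) (^-identityʳ (suc n)))))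

module _ {S T : ℕ → ℕ} where

  poly-+ : Polynomial S → Polynomial T → Polynomial (λ n → S n + T n)
  poly-+ (c , d , S≤) (c′ , d′ , T≤) = c + c′ , d + d′ , λ n → begin
    S n + T n                                        ≤⟨ +-mono-≤ (S≤ n) (T≤ n) ⟩
    c * suc n ^ d + c′ * suc n ^ d′                  ≤⟨ +-mono-≤
      (*-monoʳ-≤ c (^-monoʳ-≤ (suc n) (m≤m+n d d′)))
      (*-monoʳ-≤ c′ (^-monoʳ-≤ (suc n) (m≤n+m d′ d))) ⟩
    c * suc n ^ (d + d′) + c′ * suc n ^ (d + d′)     ≡⟨ *-distribʳ-+ (suc n ^ (d + d′)) c c′ ⟨
    (c + c′) * suc n ^ (d + d′)                      ∎
    where open ≤-Reasoning

  poly-* : Polynomial S → Polynomial T → Polynomial (λ n → S n * T n)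
  poly-* (c , d , S≤) (c′ , d′ , T≤) = c * c′ , d + d′ , λ n → begin
    S n * T n                               ≤⟨ *-mono-≤ (S≤ n) (T≤ n) ⟩
    (c * suc n ^ d) * (c′ * suc n ^ d′)     ≡⟨ [m*n]*[o*p]≡[m*o]*[n*p] c (suc n ^ d) c′ (suc n ^ d′) ⟩
    (c * c′) * (suc n ^ d * suc n ^ d′)     ≡⟨ cong (c * c′ *_) (^-distribˡ-+-* (suc n) d d′) ⟨
    (c * c′) * suc n ^ (d + d′)             ∎
    where open ≤-Reasoning

poly-suc : ∀ {T} → Polynomial T → Polynomial (λ n → suc (T n))
poly-suc = poly-+ (poly-const 1)

-- A typed language of polynomial-time programs

infixr 7 _⊗_

-- In the interpretation, `n` will be the number of vertices. A `vec` has exactly `n` entries, so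
-- traversing it is a bounded loop; a `list` may have any length.
data Type : Set where
  bool nat : Type
  _⊗_      : Type → Type → Type
  vec list : Type → Type

pattern set = vec bool
pattern mat = vec set

⟦_⟧ : Type → ℕ → Set
⟦ bool   ⟧ n = Bool
⟦ nat    ⟧ n = ℕ
⟦ A ⊗ B  ⟧ n = ⟦ A ⟧ n × ⟦ B ⟧ n
⟦ vec A  ⟧ n = Vec (⟦ A ⟧ n) n
⟦ list A ⟧ n = List (⟦ A ⟧ n)

encodeℕ : ℕ → Tree
encodeℕ zero    = nil
encodeℕ (suc m) = nil ∙ encodeℕ m

code : ∀ A → ⟦ A ⟧ n → Tree
code bool     = encodeBool
code nat      = encodeℕ
code (A ⊗ B)  = λ (a , b) → code A a ∙ code B b
code (vec A)  = λ as → encodeList (code A) (toList as)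
code (list A) = encodeList (code A)

infix 3 _⇝_

-- The time depends on `n` alone and not on the argument. Hence loops of the language run over a
-- `vec` only, and a `list` is accessed at its head.
record _⇝_ (A B : Type) : Set where
  field
    program    : Program
    fun        : ∀ n → ⟦ A ⟧ n → ⟦ B ⟧ n
    time       : ℕ → ℕ
    polynomial : Polynomial time
    runs       : ∀ n a → program $ code A a ⇓ code B (fun n a) within time n

open _⇝_

private
  variable
    A B C D E : Type

-- Replaces the computed function by its specification. Comparing codes instead of values also
-- permits a change of type, such as from a `list` to a `vec` with the same entries.
recast : (f : A ⇝ B) (g : ∀ n → ⟦ A ⟧ n → ⟦ C ⟧ n) →
         (∀ {n} a → code B (fun f n a) ≡ code C (g n a)) → A ⇝ C
recast f g eq = record
  { program    = program f
  ; fun        = g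
  ; time       = time f
  ; polynomial = polynomial f
  ; runs       = λ n a → subst (program f $ _ ⇓_within time f n) (eq a) (runs f n a)
  }

basic : (p : Program) (f : ∀ n → ⟦ A ⟧ n → ⟦ B ⟧ n) (c : ℕ) →
        (∀ n a → p $ code A a ⇓ code B (f n a) within c) → A ⇝ B
basic p f c r = record
  { program = p ; fun = f ; time = λ _ → c ; polynomial = poly-const c ; runs = r }

idᵖ : A ⇝ A
idᵖ = basic skip (λ _ a → a) 1 λ _ _ → run skip

fst : A ⊗ B ⇝ A
fst = basic hd (λ _ → proj₁) 1 λ _ _ → run hd-∙

snd : A ⊗ B ⇝ B
snd = basic tl (λ _ → proj₂) 1 λ _ _ → run tl-∙

infixl 4 _⟫_

_⟫_ : A ⇝ B → B ⇝ C → A ⇝ C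
f ⟫ g = record
  { program    = program f ⨾ program g
  ; fun        = λ n a → fun g n (fun f n a)
  ; time       = λ n → suc (time f n + time g n)
  ; polynomial = poly-suc (poly-+ (polynomial f) (polynomial g))
  ; runs       = λ n a → run-⨾ (runs f n a) (runs g n (fun f n a))
  }

infixr 5 _▵_

_▵_ : A ⇝ B → A ⇝ C → A ⇝ B ⊗ C
f ▵ g = record
  { program    = cons (program f) (program g)
  ; fun        = λ n a → fun f n a , fun g n a
  ; time       = λ n → suc (time f n + time g n)
  ; polynomial = poly-suc (poly-+ (polynomial f) (polynomial g))
  ; runs       = λ n a → run-cons (runs f n a) (runs g n a)
  }

ifᵖ : A ⇝ bool → A ⇝ B → A ⇝ B → A ⇝ B
ifᵖ {B = B} f g h = record
  { program    = if program f then program g else program h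
  ; fun        = λ n a → choose (fun f n a) (fun g n a) (fun h n a)
  ; time       = λ n → suc (time f n + (time g n + time h n))
  ; polynomial = poly-suc (poly-+ (polynomial f) (poly-+ (polynomial g) (polynomial h)))
  ; runs       = λ n a →
      subst (_ $ _ ⇓_within _) (sym (Bool.if-float (code B) (fun f n a)))
        (run-if (fun f n a) (runs f n a) (runs g n a) (runs h n a))
  }

falseᵖ : A ⇝ bool
falseᵖ = basic null (λ _ _ → false) 1 λ _ _ → run null

trueᵖ : A ⇝ bool
trueᵖ = basic (cons null null) (λ _ _ → true) 3 λ _ _ → run (cons null null)

notᵖ : A ⇝ bool → A ⇝ bool
notᵖ f = recast (ifᵖ f falseᵖ trueᵖ) (λ n a → not (fun f n a))
  λ {n} a → cong encodeBool (choose-not (fun f n a))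
  where
  choose-not : ∀ b → choose b false true ≡ not b
  choose-not true  = refl
  choose-not false = refl

infixr 6 _∧ᵖ_ _∨ᵖ_

_∧ᵖ_ _∨ᵖ_ : A ⇝ bool → A ⇝ bool → A ⇝ bool
f ∧ᵖ g = recast (ifᵖ f g falseᵖ) (λ n a → fun f n a ∧ fun g n a)
  λ {n} a → cong encodeBool (choose-∧ (fun f n a) (fun g n a))
  where
  choose-∧ : ∀ b c → choose b c false ≡ b ∧ c
  choose-∧ true  c = refl
  choose-∧ false c = refl
f ∨ᵖ g = recast (ifᵖ f trueᵖ g) (λ n a → fun f n a ∨ fun g n a)
  λ {n} a → cong encodeBool (choose-∨ (fun f n a) (fun g n a))
  where
  choose-∨ : ∀ b c → choose b true c ≡ b ∨ c
  choose-∨ true  c = refl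
  choose-∨ false c = refl

zeroᵖ : A ⇝ nat
zeroᵖ = basic null (λ _ _ → 0) 1 λ _ _ → run null

sucᵖ : nat ⇝ nat
sucᵖ = basic (cons null skip) (λ _ → suc) 3 λ _ _ → run (cons null skip)

predᵖ : nat ⇝ nat
predᵖ = basic tl (λ _ → pred) 1 λ where
  _ zero    → run tl-nil
  _ (suc _) → run tl-∙

positiveᵖ : nat ⇝ bool
positiveᵖ = basic (if skip then cons null null else null) (λ _ m → 0 <ᵇ m) 5 λ where
  _ zero    → run-≤ (s≤s (s≤s (s≤s z≤n))) (run (if-else skip null))
  _ (suc _) → run (if-then skip (cons null null))

[]ᵖ : A ⇝ list B
[]ᵖ = basic null (λ _ _ → []) 1 λ _ _ → run null

consᵖ : A ⊗ list A ⇝ list A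
consᵖ = basic skip (λ _ (a , as) → a ∷ as) 1 λ _ _ → run skip

-- The default is dictated by `hd`, which sends `nil` to `nil`, the code of `false`.
headOrFalse : List Bool → Bool
headOrFalse []      = false
headOrFalse (b ∷ _) = b

tail : List X → List X
tail = List.drop 1

headᵖ : list bool ⇝ bool
headᵖ = basic hd (λ _ → headOrFalse) 1 λ where
  _ []      → run hd-nil
  _ (_ ∷ _) → run hd-∙

tailᵖ : list A ⇝ list A
tailᵖ = basic tl (λ _ → tail) 1 λ where
  _ []      → run tl-nil
  _ (_ ∷ _) → run tl-∙

foldᵖ : A ⊗ B ⊗ E ⇝ B → vec A ⊗ B ⊗ E ⇝ B
foldᵖ {A = A} {B = B} {E = E} f = record
  { program    = foldProgram (program f)
  ; fun        = λ n (as , b , e) → foldl (λ b a → fun f n (a , b , e)) b (toList as)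
  ; time       = λ n → 6 + n * (16 + time f n)
  ; polynomial = poly-+ (poly-const 6) (poly-* poly-n (poly-+ (poly-const 16) (polynomial f)))
  ; runs       = λ n (as , b , e) →
      run-≤ (≤-reflexive (cong (λ l → 6 + l * (16 + time f n)) (Vec.length-toList as)))
        (run-fold (code A) (code B) (code E e) _ _ _ (λ _ _ → ⊤)
          (λ a _ b _ → runs f n (a , b , e) , _) (toList as) b _)
  }

toListᵖ : vec A ⇝ list A
toListᵖ = basic skip (λ _ → toList) 1 λ _ _ → run skip

reverseᵖ : vec A ⇝ vec A
reverseᵖ {A} = recast
  ((idᵖ ▵ []ᵖ ▵ falseᵖ) ⟫ foldᵖ {E = bool} ((fst ▵ (snd ⟫ fst)) ⟫ consᵖ))
  (λ _ → Vec.reverse)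
  (λ as → cong (encodeList (code A)) (sym (Vec.toList-reverse as)))

-- The state lets a single traversal consume a second vector, as in `zipᵖ`, or remember an earlier
-- find, as in `firstOutsideᵖ`.
mapAccum : (X × Z → Y × Z) → Vec X m → Z → Vec Y m
mapAccum f []       z = []
mapAccum f (x ∷ xs) z = proj₁ (f (x , z)) ∷ mapAccum f xs (proj₂ (f (x , z)))

-- The fold puts each output in front of the earlier ones, so the outputs arrive reversed;
-- `mapAccumᵖ` restores their order with `reverseᵖ`.
foldl-mapAccum : (f : X × Z → Y × Z) (xs : Vec X m) (ys : List Y) (z : Z) →
  proj₁ (foldl (λ (ys , z) x → proj₁ (f (x , z)) ∷ ys , proj₂ (f (x , z))) (ys , z) (toList xs))
    ≡ toList (mapAccum f xs z) ʳ++ ys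
foldl-mapAccum f []       ys z = refl
foldl-mapAccum f (x ∷ xs) ys z = foldl-mapAccum f xs (proj₁ (f (x , z)) ∷ ys) (proj₂ (f (x , z)))

mapAccumᵖ : A ⊗ B ⇝ C ⊗ B → vec A ⊗ B ⇝ vec C
mapAccumᵖ {A} {B} {C} f = recast (reversed ⟫ reverseᵖ)
  (λ n (as , b) → mapAccum (fun f n) as b)
  (λ (as , b) → cong (code (vec C)) (Vec.reverse-involutive _))
  where
  step : A ⊗ (list C ⊗ B) ⊗ bool ⇝ list C ⊗ B
  step = ((fst ▵ (snd ⟫ fst ⟫ snd)) ⟫ f) ▵ (snd ⟫ fst ⟫ fst)
       ⟫ (((fst ⟫ fst) ▵ snd) ⟫ consᵖ) ▵ (fst ⟫ snd)

  reversed : vec A ⊗ B ⇝ vec C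
  reversed = recast ((fst ▵ ([]ᵖ ▵ snd) ▵ falseᵖ) ⟫ foldᵖ step ⟫ fst)
    (λ n (as , b) → Vec.reverse (mapAccum (fun f n) as b))
    (λ {n} (as , b) → cong (encodeList (code C))
      (trans (foldl-mapAccum (fun f n) as [] b)
        (sym (Vec.toList-reverse (mapAccum (fun f n) as b)))))

zipᵖ : bool ⊗ bool ⇝ bool → set ⊗ set ⇝ set
zipᵖ f = recast ((fst ▵ (snd ⟫ toListᵖ)) ⟫ mapAccumᵖ step)
  (λ n (p , q) → zipWith (λ a b → fun f n (a , b)) p q)
  (λ {n} (p , q) → cong (code set) (mapAccum-zip n p q))
  where
  -- The state is the unread rest of the second set, which loses its head at each step.
  step : bool ⊗ list bool ⇝ bool ⊗ list bool
  step = ((fst ▵ (snd ⟫ headᵖ)) ⟫ f) ▵ (snd ⟫ tailᵖ)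

  mapAccum-zip : ∀ n (p q : Vec Bool m) →
    mapAccum (fun step n) p (toList q) ≡ zipWith (λ a b → fun f n (a , b)) p q
  mapAccum-zip n []      []      = refl
  mapAccum-zip n (a ∷ p) (b ∷ q) = cong (_ ∷_) (mapAccum-zip n p q)

mapAccum-stateless : (f : X → Y) (xs : Vec X m) (z : Z) →
                     mapAccum (λ (x , z) → f x , z) xs z ≡ Vec.map f xs
mapAccum-stateless f []       z = refl
mapAccum-stateless f (x ∷ xs) z = cong (f x ∷_) (mapAccum-stateless f xs z)

-- The argument tells the program how many entries to write.
∅ᵖ : vec A ⇝ set
∅ᵖ = recast ((idᵖ ▵ falseᵖ) ⟫ mapAccumᵖ {B = bool} (falseᵖ ▵ snd)) (λ _ _ → ∅)
  (λ as → cong (code set) (trans (mapAccum-stateless _ as false) (Vec.map-const as false)))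

∁ᵖ : set ⇝ set
∁ᵖ = recast ((idᵖ ▵ falseᵖ) ⟫ mapAccumᵖ {B = bool} (notᵖ fst ▵ snd)) (λ _ → ∁)
  (λ p → cong (code set) (mapAccum-stateless not p false))

infixr 6 _∪ᵖ_
infixr 7 _∩ᵖ_

_∪ᵖ_ _∩ᵖ_ : A ⇝ set → A ⇝ set → A ⇝ set
f ∪ᵖ g = (f ▵ g) ⟫ zipᵖ (fst ∨ᵖ snd)
f ∩ᵖ g = (f ▵ g) ⟫ zipᵖ (fst ∧ᵖ snd)

inhabited : Subset m → Bool
inhabited []      = false
inhabited (b ∷ p) = b ∨ inhabited p

inhabitedᵖ : set ⇝ bool
inhabitedᵖ = recast ((idᵖ ▵ falseᵖ ▵ falseᵖ) ⟫ foldᵖ {E = bool} ((snd ⟫ fst) ∨ᵖ fst))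
  (λ _ → inhabited) (λ p → cong encodeBool (foldl-∨ p false))
  where
  foldl-∨ : (p : Subset m) (a : Bool) → foldl (λ a b → a ∨ b) a (toList p) ≡ a ∨ inhabited p
  foldl-∨ []      a = sym (Bool.∨-identityʳ a)
  foldl-∨ (b ∷ p) a = trans (foldl-∨ p (a ∨ b)) (Bool.∨-assoc a b (inhabited p))

∣_∣ᵖ : A ⇝ set → A ⇝ nat
∣ f ∣ᵖ = f ⟫ recast
  ((idᵖ ▵ zeroᵖ ▵ falseᵖ) ⟫ foldᵖ {E = bool} (ifᵖ fst (snd ⟫ fst ⟫ sucᵖ) (snd ⟫ fst)))
  (λ _ → ∣_∣) (λ p → cong encodeℕ (trans (foldl-suc p 0) (+-identityʳ ∣ p ∣)))
  where
  foldl-suc : (p : Subset m) (k : ℕ) →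
              foldl (λ k b → choose b (suc k) k) k (toList p) ≡ ∣ p ∣ + k
  foldl-suc []          k = refl
  foldl-suc (true ∷ p)  k = trans (foldl-suc p (suc k)) (+-suc ∣ p ∣ k)
  foldl-suc (false ∷ p) k = foldl-suc p k

-- Subtracting by one `pred` per element is the means to compare cardinalities: the difference is
-- positive exactly when the first is larger.
_∸∣_∣ᵖ : A ⇝ nat → A ⇝ set → A ⇝ nat
f ∸∣ g ∣ᵖ = (g ▵ f) ⟫ recast
  ((fst ▵ snd ▵ falseᵖ) ⟫ foldᵖ {E = bool} (ifᵖ fst (snd ⟫ fst ⟫ predᵖ) (snd ⟫ fst)))
  (λ _ (p , k) → k ∸ ∣ p ∣) (λ (p , k) → cong encodeℕ (foldl-pred p k))
  where
  foldl-pred : (p : Subset m) (k : ℕ) →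
               foldl (λ k b → choose b (pred k) k) k (toList p) ≡ k ∸ ∣ p ∣
  foldl-pred []          k       = refl
  foldl-pred (true ∷ p)  zero    = trans (foldl-pred p zero) (0∸n≡0 ∣ p ∣)
  foldl-pred (true ∷ p)  (suc k) = foldl-pred p k
  foldl-pred (false ∷ p) k       = foldl-pred p k

-- The polynomial-time parts of the algorithm

larger : Subset n → Subset n → Subset n
larger p q = choose (0 <ᵇ (∣ p ∣ ∸ ∣ q ∣)) p q

-- For an adjacency matrix this is the neighbourhood of a vertex of maximum degree, or `∅` if there
-- is no vertex.
largestRow : List (Subset n) → Subset n
largestRow = foldl (λ p row → larger row p) ∅

largestRowᵖ : mat ⇝ set
largestRowᵖ = recast
  ((idᵖ ▵ ∅ᵖ ▵ falseᵖ) ⟫ foldᵖ {E = bool}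
    ((fst ▵ (snd ⟫ fst)) ⟫ ifᵖ ((∣ fst ∣ᵖ ∸∣ snd ∣ᵖ) ⟫ positiveᵖ) fst snd))
  (λ _ M → largestRow (toList M)) (λ _ → refl)

joinRows : Vec (Subset n) m → Subset m → Subset n → Subset n
joinRows []        []      q = q
joinRows (row ∷ M) (b ∷ p) q = joinRows M p (choose b (row ∪ q) q)

neighbours : Vec (Subset n) m → Subset m → Subset n
neighbours M p = joinRows M p ∅

neighboursᵖ : A ⇝ mat → A ⇝ set → A ⇝ set
neighboursᵖ f g = (f ▵ g) ⟫ recast
  ((fst ▵ ((snd ⟫ toListᵖ) ▵ (snd ⟫ ∅ᵖ)) ▵ falseᵖ) ⟫ foldᵖ step ⟫ snd)
  (λ _ (M , p) → neighbours M p)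
  (λ {n} (M , p) → cong (code set) (foldl-joinRows n M p ∅))
  where
  step : set ⊗ (list bool ⊗ set) ⊗ bool ⇝ list bool ⊗ set
  step = (snd ⟫ fst ⟫ fst ⟫ tailᵖ)
       ▵ ifᵖ (snd ⟫ fst ⟫ fst ⟫ headᵖ) (fst ∪ᵖ (snd ⟫ fst ⟫ snd)) (snd ⟫ fst ⟫ snd)

  foldl-joinRows : ∀ n (M : Vec (Subset n) m) (p : Subset m) (q : Subset n) →
    proj₂ (foldl (λ b row → fun step n (row , b , false)) (toList p , q) (toList M)) ≡ joinRows M p q
  foldl-joinRows n []        []      q = refl
  foldl-joinRows n (row ∷ M) (b ∷ p) q = foldl-joinRows n M p _

grow : Vec (Subset n) n → Subset n → Subset n → Subset n
grow M S R = R ∪ neighbours M R ∩ ∁ S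

-- Breadth-first search from `R` that never enters `S`. By `fold-stable`, `n` rounds suffice.
reach : Vec (Subset n) n → Subset n → Subset n → Subset n
reach {n} M S R = fold R (grow M S) n

reachᵖ : A ⇝ mat → A ⇝ set → A ⇝ set → A ⇝ set
reachᵖ f g h = (f ▵ g ▵ h) ⟫ recast
  -- The matrix plays two parts: its `n` rows count the rounds, and a copy in the environment
  -- supplies the adjacencies.
  ((fst ▵ (snd ⟫ snd) ▵ fst ▵ (snd ⟫ fst)) ⟫ foldᵖ step)
  (λ _ (M , S , R) → reach M S R)
  (λ (M , S , R) → cong (code set) (foldl-grow M S R M))
  where
  step : set ⊗ set ⊗ mat ⊗ set ⇝ set
  step = snd ⟫ fst ∪ᵖ (neighboursᵖ (snd ⟫ fst) fst ∩ᵖ (snd ⟫ snd ⟫ ∁ᵖ))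

  foldl-grow : ∀ (M : Vec (Subset n) n) S R (L : Vec (Subset n) m) →
               foldl (λ R _ → grow M S R) R (toList L) ≡ fold R (grow M S) m
  foldl-grow M S R []                = refl
  foldl-grow M S R (_∷_ {n = m} _ L) = trans (foldl-grow M S _ L) (fold-pull m)
    where
    fold-pull : ∀ m → fold (grow M S R) (grow M S) m ≡ grow M S (fold R (grow M S) m)
    fold-pull zero    = refl
    fold-pull (suc m) = cong (grow M S) (fold-pull m)

-- The start of the search, namely the singleton of the first vertex outside `S`, or `∅` if there is
-- none.
firstOutside : Subset m → Bool → Subset m
firstOutside S found = mapAccum (λ (b , found) → not b ∧ not found , found ∨ not b) S found

firstOutsideᵖ : A ⇝ set → A ⇝ set
firstOutsideᵖ f = (f ▵ falseᵖ) ⟫ mapAccumᵖ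
  ((notᵖ fst ∧ᵖ notᵖ snd) ▵ (snd ∨ᵖ notᵖ fst))

-- A graph is connected as soon as one vertex reaches all others, so one search decides whether `S`
-- is a cutset. If `S` contains every vertex, nothing is left unreached and the answer is `false`,
-- in accordance with the convention on the empty graph.
isIndependentCutset : Vec (Subset n) n → Subset n → Bool
isIndependentCutset M S =
  not (inhabited (neighbours M S ∩ S)) ∧ inhabited (∁ (S ∪ reach M S (firstOutside S false)))

isIndependentCutsetᵖ : A ⇝ mat → A ⇝ set → A ⇝ bool
isIndependentCutsetᵖ f g = (f ▵ g) ⟫
  notᵖ ((neighboursᵖ fst snd ∩ᵖ snd) ⟫ inhabitedᵖ) ∧ᵖ
  ((snd ∪ᵖ reachᵖ fst snd (firstOutsideᵖ snd)) ⟫ ∁ᵖ ⟫ inhabitedᵖ)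

boundary : Vec (Subset n) n → Subset n → Subset n
boundary M X = neighbours M X ∩ ∁ X

succeeds : Vec (Subset n) n → Subset n → Bool
succeeds M X = isIndependentCutset M X ∨ isIndependentCutset M (boundary M X)

succeedsᵖ : A ⇝ mat → A ⇝ set → A ⇝ bool
succeedsᵖ f g = (f ▵ g) ⟫
  isIndependentCutsetᵖ fst snd ∨ᵖ isIndependentCutsetᵖ fst (neighboursᵖ fst snd ∩ᵖ (snd ⟫ ∁ᵖ))

anySucceedsᵖ : set ⊗ bool ⊗ mat ⇝ bool
anySucceedsᵖ = recast ((snd ⟫ fst) ∨ᵖ succeedsᵖ (snd ⟫ snd) fst)
  (λ _ (X , b , M) → b ∨ succeeds M X) (λ _ → refl)

-- Enumeration of the subsets of a complement

-- The flag `b` tells whether the new element lies in the set whose complement is considered; if it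
-- does, it must be left out. Since `_◃_` is a parameter, the same function handles the lists of the
-- program and the vectors of `candidates`.
extend : (Bool → X → Y) → Bool → List Y → X → List Y
extend _◃_ b ys x = choose b (false ◃ x ∷ ys) (true ◃ x ∷ false ◃ x ∷ ys)

expand : List (List Bool) → Bool → List (List Bool)
expand Xs b = foldl (extend _∷_ b) [] Xs

extendᵖ : list bool ⊗ list (list bool) ⊗ bool ⇝ list (list bool)
extendᵖ = recast (ifᵖ (snd ⟫ snd) without ((((trueᵖ ▵ fst) ⟫ consᵖ) ▵ without) ⟫ consᵖ))
  (λ _ (X , Xs , b) → extend _∷_ b Xs X) (λ _ → refl)
  where
  without : list bool ⊗ list (list bool) ⊗ bool ⇝ list (list bool)
  without = (((falseᵖ ▵ fst) ⟫ consᵖ) ▵ (snd ⟫ fst)) ⟫ consᵖ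

expandSetup : bool ⊗ list (list bool) ⊗ E ⇝ list (list bool) ⊗ list (list bool) ⊗ bool
expandSetup = (snd ⟫ fst) ▵ []ᵖ ▵ fst

-- The list traversed here can be exponentially long. The loop therefore stands outside `_⇝_`, and
-- `expandTime` takes the length as a second argument.
expandProgram : Program
expandProgram = program (expandSetup {mat}) ⨾ foldProgram (program extendᵖ)

expandTime : ℕ → ℕ → ℕ
expandTime n L = suc (time (expandSetup {mat}) n + (6 + L * (16 + time extendᵖ n)))

run-expand : ∀ n b Xs (M : ⟦ mat ⟧ n) →
  expandProgram $ code (bool ⊗ list (list bool) ⊗ mat) (b , Xs , M)
    ⇓ code {n} (list (list bool)) (expand Xs b) within expandTime n (length Xs)
run-expand n b Xs M = run-⨾ (runs expandSetup n (b , Xs , M))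
  (run-fold (code {n} (list bool)) (code {n} (list (list bool))) (encodeBool b) (extend _∷_ b) _ _
    (λ _ _ → ⊤) (λ X _ Ys _ → runs extendᵖ n (X , Ys , b) , _) Xs [] _)

weight : List Bool → ℕ
weight bs = product (List.map (λ b → choose b 1 2) bs)

weight>0 : ∀ bs → weight bs > 0
weight>0 []           = s≤s z≤n
weight>0 (true ∷ bs)  = ≤-trans (weight>0 bs) (m≤m+n _ 0)
weight>0 (false ∷ bs) = ≤-trans (weight>0 bs) (m≤m+n _ _)

length-extend : (_◃_ : Bool → X → Y) (b : Bool) (xs : List X) (ys : List Y) →
                length (foldl (extend _◃_ b) ys xs) ≡ length xs * choose b 1 2 + length ys
length-extend c b     []       ys = refl
length-extend c true  (x ∷ xs) ys = trans (length-extend c true xs _) (+-suc _ _)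
length-extend c false (x ∷ xs) ys =
  trans (length-extend c false xs _) (trans (+-suc _ _) (cong suc (+-suc _ _)))

length-expand : ∀ Xs b → length (expand Xs b) ≡ length Xs * choose b 1 2
length-expand Xs b = trans (length-extend _∷_ b Xs []) (+-identityʳ _)

enumerateProgram : Program
enumerateProgram = foldProgram expandProgram

-- Each set enumerated so far has `weight bs` extensions, where bs is the list of
-- the entries still to come; so this number times that of the sets is invariant.

run-enumerate : ∀ n (p : Vec Bool n) (M : ⟦ mat ⟧ n) →
  enumerateProgram $ code (set ⊗ list (list bool) ⊗ mat) (p , [] ∷ [] , M)
    ⇓ code {n} (list (list bool)) (foldl expand ([] ∷ []) (toList p))
    within 6 + n * (16 + expandTime n (weight (toList p)))
run-enumerate n p M =
  run-≤ (≤-reflexive (cong (λ l → 6 + l * (16 + expandTime n L)) (Vec.length-toList p)))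
    (run-fold encodeBool (code {n} (list (list bool))) (code mat M) expand expandProgram _
      (λ bs Xs → length Xs * weight bs ≡ L) step (toList p) ([] ∷ []) (*-identityˡ L))
  where
  L : ℕ
  L = weight (toList p)

  step : ∀ b bs Xs → length Xs * weight (b ∷ bs) ≡ L →
    (expandProgram $ encodeBool b ∙ code {n} (list (list bool)) Xs ∙ code mat M
      ⇓ code {n} (list (list bool)) (expand Xs b) within expandTime n L)
    × length (expand Xs b) * weight bs ≡ L
  step b bs Xs eq =
      run-≤ (s≤s (+-monoʳ-≤ (time (expandSetup {mat}) n) (+-monoʳ-≤ 6 (*-monoˡ-≤ _ length≤L))))
        (run-expand n b Xs M)
    , (begin-equality
         length (expand Xs b) * weight bs         ≡⟨ cong (_* weight bs) (length-expand Xs b) ⟩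
         length Xs * choose b 1 2 * weight bs     ≡⟨ *-assoc (length Xs) _ _ ⟩
         length Xs * weight (b ∷ bs)              ≡⟨ eq ⟩
         L                                        ∎)
    where
    open ≤-Reasoning
    -- The weight still to come is at least 1, so no intermediate list is longer than `L`.
    length≤L : length Xs ≤ L
    length≤L = begin
      length Xs                   ≤⟨ m≤m*n (length Xs) _ {{>-nonZero (weight>0 (b ∷ bs))}} ⟩
      length Xs * weight (b ∷ bs) ≡⟨ eq ⟩
      L                           ∎

weight-reverse : ∀ bs → weight (List.reverse bs) ≡ weight bs
weight-reverse bs = product-↭ (↭-map⁺ _ (↭-reverse bs))

weight-toList : (p : Subset m) → weight (toList p) ≡ 2 ^ ∣ ∁ p ∣
weight-toList []          = refl
weight-toList (true ∷ p)  = trans (*-identityˡ _) (weight-toList p)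
weight-toList (false ∷ p) = cong (2 *_) (weight-toList p)

candidates : Subset m → List (Subset m)
candidates []      = [] ∷ []
candidates (b ∷ p) = foldl (extend _∷_ b) [] (candidates p)

length-candidates : (p : Subset m) → length (candidates p) ≡ 2 ^ ∣ ∁ p ∣
length-candidates []      = refl
length-candidates (b ∷ p) = begin
  length (candidates (b ∷ p))             ≡⟨ length-extend _∷_ b (candidates p) [] ⟩
  length (candidates p) * choose b 1 2 + 0 ≡⟨ +-identityʳ _ ⟩
  length (candidates p) * choose b 1 2    ≡⟨ *-comm (length (candidates p)) _ ⟩
  choose b 1 2 * length (candidates p)    ≡⟨ cong (choose b 1 2 *_) (length-candidates p) ⟩
  choose b 1 2 * 2 ^ ∣ ∁ p ∣              ≡⟨ 2^∣∁∣ b ⟩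
  2 ^ ∣ ∁ (b ∷ p) ∣                       ∎
  where
  open ≡-Reasoning
  2^∣∁∣ : ∀ b → choose b 1 2 * 2 ^ ∣ ∁ p ∣ ≡ 2 ^ ∣ ∁ (b ∷ p) ∣
  2^∣∁∣ true  = *-identityˡ _
  2^∣∁∣ false = refl

foldl-extend-toList : (b : Bool) (Xs : List (Subset m)) (Ys : List (Subset (suc m))) →
  foldl (extend _∷_ b) (List.map toList Ys) (List.map toList Xs)
    ≡ List.map toList (foldl (extend _∷_ b) Ys Xs)
foldl-extend-toList b     []       Ys = refl
foldl-extend-toList true  (X ∷ Xs) Ys = foldl-extend-toList true Xs _
foldl-extend-toList false (X ∷ Xs) Ys = foldl-extend-toList false Xs _

-- Entries are attached in front, so the last entry of `p` must be treated first. Reversing `p`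
-- turns the left fold of the program into the right fold that `candidates` performs.
foldl-expand-reverse : (p : Subset m) →
  foldl expand ([] ∷ []) (toList (Vec.reverse p)) ≡ List.map toList (candidates p)
foldl-expand-reverse p = begin
  foldl expand ([] ∷ []) (toList (Vec.reverse p))        ≡⟨ cong (foldl expand _) (Vec.toList-reverse p) ⟩
  foldl expand ([] ∷ []) (List.reverse (toList p))       ≡⟨ List.reverse-foldl expand _ (toList p) ⟩
  List.foldr (flip expand) ([] ∷ []) (toList p)          ≡⟨ go p ⟩
  List.map toList (candidates p)                         ∎
  where
  open ≡-Reasoning
  go : (p : Subset m) → List.foldr (flip expand) ([] ∷ []) (toList p) ≡ List.map toList (candidates p)
  go []      = refl
  go (b ∷ p) = trans (cong (flip expand b) (go p)) (foldl-extend-toList b (candidates p) [])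

foldl-extend-⊇ : (c : Bool → X → Y) (b : Bool) (xs : List X) {ys : List Y} {y : Y} →
                 y ∈ₗ ys → y ∈ₗ foldl (extend c b) ys xs
foldl-extend-⊇ c b     []       y∈ = y∈
foldl-extend-⊇ c true  (_ ∷ xs) y∈ = foldl-extend-⊇ c true xs (there y∈)
foldl-extend-⊇ c false (_ ∷ xs) y∈ = foldl-extend-⊇ c false xs (there (there y∈))

foldl-extend-false : (c : Bool → X → Y) (b : Bool) {xs : List X} {ys : List Y} {x : X} →
                     x ∈ₗ xs → c false x ∈ₗ foldl (extend c b) ys xs
foldl-extend-false c true  {_ ∷ xs} (here refl) = foldl-extend-⊇ c true xs (here refl)
foldl-extend-false c false {_ ∷ xs} (here refl) = foldl-extend-⊇ c false xs (there (here refl))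
foldl-extend-false c true  (there x∈)  = foldl-extend-false c true x∈
foldl-extend-false c false (there x∈)  = foldl-extend-false c false x∈

foldl-extend-true : (c : Bool → X → Y) {xs : List X} {ys : List Y} {x : X} →
                    x ∈ₗ xs → c true x ∈ₗ foldl (extend c false) ys xs
foldl-extend-true c {_ ∷ xs} (here refl) = foldl-extend-⊇ c false xs (here refl)
foldl-extend-true c (there x∈)           = foldl-extend-true c x∈

∈-candidates : (p X : Subset m) → (∀ {x} → x ∈ X → x ∉ p) → X ∈ₗ candidates p
∈-candidates []          []          X∩p≡∅ = here refl
∈-candidates (b ∷ p)     (false ∷ X) X∩p≡∅ =
  foldl-extend-false _∷_ b (∈-candidates p X λ x∈X x∈p → X∩p≡∅ (Vec.there x∈X) (Vec.there x∈p))
∈-candidates (false ∷ p) (true ∷ X)  X∩p≡∅ =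
  foldl-extend-true _∷_ (∈-candidates p X λ x∈X x∈p → X∩p≡∅ (Vec.there x∈X) (Vec.there x∈p))
∈-candidates (true ∷ p)  (true ∷ X)  X∩p≡∅ = contradiction Vec.here (X∩p≡∅ Vec.here)

-- The algorithm and its running time

solve : Vec (Subset n) n → Bool
solve M = foldl (λ b X → b ∨ succeeds M X) false (candidates (largestRow (toList M)))

prepareᵖ : mat ⇝ set ⊗ list (list bool) ⊗ mat
prepareᵖ = (largestRowᵖ ⟫ reverseᵖ) ▵ (([]ᵖ {B = bool} ▵ []ᵖ) ⟫ consᵖ) ▵ idᵖ

solver : Program
solver = program prepareᵖ
       -- Sets up the store of the last fold: the candidates to traverse, `null` as the initial
       -- answer `false`, and the matrix, which is found under `tl ⨾ tl`.
       ⨾ cons enumerateProgram (cons null (tl ⨾ tl))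
       ⨾ foldProgram (program anySucceedsᵖ)

-- The time found in `run-solver` has the form `α + β * L`, where `L` is the number of candidates.
-- The value here is `α + β`; since `L` is positive, multiplying it by `L` covers both summands.
solveTime : ℕ → ℕ
solveTime n =
  suc (time prepareᵖ n + suc (suc (6 + n * (16 + suc (time (expandSetup {mat}) n + 6)) + 5) + 6))
  + (n * (16 + time extendᵖ n) + (16 + time anySucceedsᵖ n))

-- Abstract, because the constants are too large to be unfolded.
abstract
  solveTime-polynomial : Polynomial solveTime
  solveTime-polynomial =
    poly-+ (poly-suc (poly-+ (polynomial prepareᵖ)
             (poly-suc (poly-+ (poly-suc (poly-+ (poly-+ (poly-const 6)
               (poly-* poly-n (poly-+ (poly-const 16)
                 (poly-suc (poly-+ (polynomial (expandSetup {mat})) (poly-const 6))))))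
               (poly-const 5))) (poly-const 6)))))
           (poly-+ (poly-* poly-n (poly-+ (poly-const 16) (polynomial extendᵖ)))
             (poly-+ (poly-const 16) (polynomial anySucceedsᵖ)))

run-solver : ∀ n (M : Vec (Subset n) n) →
  solver $ code mat M ⇓ encodeBool (solve M)
    within solveTime n * 2 ^ ∣ ∁ (largestRow (toList M)) ∣
run-solver n M = run-≤ bound
  (run-⨾ (runs prepareᵖ n M)
    (run-⨾ (run-cons enumerated (run-cons (run null) (run-⨾ (run tl-∙) (run tl-∙))))
      (run-fold (code set) encodeBool (code mat M) (λ b X → b ∨ succeeds M X) _ _ (λ _ _ → ⊤)
        (λ X _ b _ → runs anySucceedsᵖ n (X , b , M) , _) Xs false _)))
  where
  best : Subset n
  best = largestRow (toList M)
  Xs : List (Subset n)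
  Xs = candidates best
  L : ℕ
  L = 2 ^ ∣ ∁ best ∣

  start : Tree
  start = code (set ⊗ list (list bool) ⊗ mat) (Vec.reverse best , [] ∷ [] , M)

  enumerated : enumerateProgram $ start ⇓ encodeList (code set) Xs within 6 + n * (16 + expandTime n L)
  enumerated = subst₂ (enumerateProgram $ start ⇓_within_)
    -- The lists of Booleans that the program builds have the same codes as the vectors in
    -- `candidates`.
    (trans (cong (encodeList (encodeList encodeBool)) (foldl-expand-reverse best)) (encodeList-map Xs))
    (cong (λ L → 6 + n * (16 + expandTime n L))
      (trans (cong weight (Vec.toList-reverse best))
        (trans (weight-reverse (toList best)) (weight-toList best))))
    (run-enumerate n (Vec.reverse best) M)
    where
    encodeList-map : (Xs : List (Subset n)) →
      encodeList (encodeList encodeBool) (List.map toList Xs) ≡ encodeList (code {n} set) Xs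
    encodeList-map []       = refl
    encodeList-map (X ∷ Xs) = cong (_ ∙_) (encodeList-map Xs)

  bound : suc (time prepareᵖ n + suc (suc (6 + n * (16 + expandTime n L) + suc (1 + 3))
            + (6 + length Xs * (16 + time anySucceedsᵖ n)))) ≤ solveTime n * L
  bound rewrite length-candidates best = begin
    _                             ≡⟨ linear (time prepareᵖ n) n (time (expandSetup {mat}) n)
                                       (time extendᵖ n) (time anySucceedsᵖ n) L ⟩
    α + β * L                     ≤⟨ +-monoˡ-≤ (β * L) (m≤m*n α L {{m^n≢0 2 ∣ ∁ best ∣}}) ⟩
    α * L + β * L                 ≡⟨ *-distribʳ-+ L α β ⟨
    solveTime n * L               ∎
    where
    open ≤-Reasoning
    α = suc (time prepareᵖ n + suc (suc (6 + n * (16 + suc (time (expandSetup {mat}) n + 6)) + 5) + 6))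
    β = n * (16 + time extendᵖ n) + (16 + time anySucceedsᵖ n)
    linear : ∀ a n b c d L →
      suc (a + suc (suc (6 + n * (16 + suc (b + (6 + L * (16 + c)))) + suc (1 + 3))
        + (6 + L * (16 + d))))
      ≡ suc (a + suc (suc (6 + n * (16 + suc (b + 6)) + 5) + 6)) + (n * (16 + c) + (16 + d)) * L
    linear = solve-∀

-- Correctness

reflects-map : ∀ {P Q : Set} {b} → (P → Q) → (Q → P) → Reflects P b → Reflects Q b
reflects-map f g r = proof (map′ f g (_ because r))

reflects-sound : ∀ {P : Set} {b} → Reflects P b → T b → P
reflects-sound (ofʸ p) _ = p

reflects-complete : ∀ {P : Set} {b} → Reflects P b → P → T b
reflects-complete (ofʸ _)  _ = _
reflects-complete (ofⁿ ¬p) p = ¬p p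

inhabited-reflects : (p : Subset m) → Reflects (Nonempty p) (inhabited p)
inhabited-reflects []          = ofⁿ λ ()
inhabited-reflects (true ∷ p)  = ofʸ (zero , Vec.here)
inhabited-reflects (false ∷ p) = reflects-map
  (λ (x , x∈p) → suc x , Vec.there x∈p) (λ { (suc x , Vec.there x∈p) → x , x∈p })
  (inhabited-reflects p)

∈-joinRows⁺ : (M : Vec (Subset n) m) (p : Subset m) {q : Subset n} {w : Fin n} →
  w ∈ q ⊎ (∃[ u ] u ∈ p × w ∈ Vec.lookup M u) → w ∈ joinRows M p q
∈-joinRows⁺ []        []          (inj₁ w∈q) = w∈q
∈-joinRows⁺ (row ∷ M) (true ∷ p)  (inj₁ w∈q) = ∈-joinRows⁺ M p (inj₁ (x∈p∪q⁺ (inj₂ w∈q)))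
∈-joinRows⁺ (row ∷ M) (false ∷ p) (inj₁ w∈q) = ∈-joinRows⁺ M p (inj₁ w∈q)
∈-joinRows⁺ (row ∷ M) (true ∷ p)  (inj₂ (zero , _ , w∈row)) =
  ∈-joinRows⁺ M p (inj₁ (x∈p∪q⁺ (inj₁ w∈row)))
∈-joinRows⁺ (row ∷ M) (_ ∷ p)     (inj₂ (suc u , Vec.there u∈p , w∈)) =
  ∈-joinRows⁺ M p (inj₂ (u , u∈p , w∈))

∈-joinRows⁻ : (M : Vec (Subset n) m) (p : Subset m) {q : Subset n} {w : Fin n} →
  w ∈ joinRows M p q → w ∈ q ⊎ (∃[ u ] u ∈ p × w ∈ Vec.lookup M u)
∈-joinRows⁻ []        []      w∈q = inj₁ w∈q
∈-joinRows⁻ (row ∷ M) (b ∷ p) w∈ with ∈-joinRows⁻ M p w∈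
∈-joinRows⁻ (row ∷ M) (b ∷ p)     w∈ | inj₂ (u , u∈p , w∈u) = inj₂ (suc u , Vec.there u∈p , w∈u)
∈-joinRows⁻ (row ∷ M) (false ∷ p) w∈ | inj₁ w∈q = inj₁ w∈q
∈-joinRows⁻ (row ∷ M) (true ∷ p)  w∈ | inj₁ w∈q with x∈p∪q⁻ row _ w∈q
... | inj₁ w∈row = inj₂ (zero , Vec.here , w∈row)
... | inj₂ w∈q′  = inj₁ w∈q′

-- A chain of subsets of an n-element set that has not become stationary
-- before step j has gained j elements.

module _ (g : Subset n → Subset n) (g-inflationary : ∀ R → R ⊆ g R) (R : Subset n) where

  private
    stable⊎large : ∀ j → g (fold R g j) ⊆ fold R g j ⊎ j ≤ ∣ fold R g j ∣
    stable⊎large zero    = inj₂ z≤n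
    stable⊎large (suc j) with stable⊎large j
    ... | inj₁ stable = inj₁ (subst (λ Q → g Q ⊆ Q) (⊆-antisym (g-inflationary _) stable) stable)
    ... | inj₂ j≤ with any? (λ x → (x ∈? g (fold R g j)) ×-dec ¬? (x ∈? fold R g j))
    ...   | yes (x , x∈ , x∉) =
            inj₂ (≤-trans (s≤s j≤) (p⊂q⇒∣p∣<∣q∣ (g-inflationary _ , x , x∈ , x∉)))
    ...   | no ∄ = inj₁ (subst (λ Q → g Q ⊆ Q) (⊆-antisym (g-inflationary _) stable) stable)
      where
      stable : g (fold R g j) ⊆ fold R g j
      stable {x} x∈ = decidable-stable (x ∈? _) λ x∉ → ∄ (x , x∈ , x∉)

  fold-stable : g (fold R g n) ⊆ fold R g n
  fold-stable with stable⊎large n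
  ... | inj₁ stable = stable
  -- A subset with `n` elements is full, so `g` cannot enlarge it.
  ... | inj₂ n≤ = λ _ → subst (_ ∈_) (sym (∣p∣≡n⇒p≡⊤ (≤-antisym (∣p∣≤n (fold R g n)) n≤))) ∈⊤

  fold-⊇ : ∀ j → R ⊆ fold R g j
  fold-⊇ zero    x∈R = x∈R
  fold-⊇ (suc j) x∈R = g-inflationary _ (fold-⊇ j x∈R)

firstOutside-found : (p : Subset m) → firstOutside p true ≡ ∅
firstOutside-found []          = refl
firstOutside-found (true ∷ p)  = cong (false ∷_) (firstOutside-found p)
firstOutside-found (false ∷ p) = cong (false ∷_) (firstOutside-found p)

firstOutside-⁅⁆ : (p : Subset m) →
  (∃[ s ] s ∉ p × firstOutside p false ≡ ⁅ s ⁆) ⊎ (∀ x → x ∈ p)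
firstOutside-⁅⁆ []          = inj₂ λ ()
firstOutside-⁅⁆ (false ∷ p) = inj₁ (zero , (λ ()) , cong (true ∷_) (firstOutside-found p))
firstOutside-⁅⁆ (true ∷ p)  with firstOutside-⁅⁆ p
... | inj₁ (s , s∉p , eq) = inj₁ (suc s , (λ { (Vec.there s∈p) → s∉p s∈p }) , cong (false ∷_) eq)
... | inj₂ full           = inj₂ λ { zero → Vec.here ; (suc x) → Vec.there (full x) }

module _ (p q : Subset n) where

  ∣p∣≤∣larger∣ : ∣ p ∣ ≤ ∣ larger p q ∣
  ∣p∣≤∣larger∣ with ∣ p ∣ ∸ ∣ q ∣ in eq
  ... | zero  = m∸n≡0⇒m≤n eq
  ... | suc _ = ≤-refl

  ∣q∣≤∣larger∣ : ∣ q ∣ ≤ ∣ larger p q ∣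
  ∣q∣≤∣larger∣ with ∣ p ∣ ∸ ∣ q ∣ in eq
  ... | zero  = ≤-refl
  ... | suc _ = <⇒≤ (m∸n≢0⇒n<m (λ eq′ → 1+n≢0 (trans (sym eq) eq′)))

  larger-sel : larger p q ≡ p ⊎ larger p q ≡ q
  larger-sel with ∣ p ∣ ∸ ∣ q ∣
  ... | zero  = inj₂ refl
  ... | suc _ = inj₁ refl

largestRow-largest : (rows : List (Subset n)) → All (λ row → ∣ row ∣ ≤ ∣ largestRow rows ∣) rows
largestRow-largest rows = proj₂ (go rows ∅)
  where
  go : ∀ rows p → let q = foldl (λ p row → larger row p) p rows in
       ∣ p ∣ ≤ ∣ q ∣ × All (λ row → ∣ row ∣ ≤ ∣ q ∣) rows
  go []           p = ≤-refl , []
  go (row ∷ rows) p with go rows (larger row p)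
  ... | init , all = ≤-trans (∣q∣≤∣larger∣ row p) init , ≤-trans (∣p∣≤∣larger∣ row p) init ∷ all

largestRow-sel : (rows : List (Subset n)) → largestRow rows ≡ ∅ ⊎ largestRow rows ∈ₗ rows
largestRow-sel rows = go rows ∅
  where
  go : ∀ rows p → let q = foldl (λ p row → larger row p) p rows in q ≡ p ⊎ q ∈ₗ rows
  go []           p = inj₁ refl
  go (row ∷ rows) p with go rows (larger row p)
  ... | inj₂ q∈rows = inj₂ (there q∈rows)
  ... | inj₁ q≡ with larger-sel row p
  ...   | inj₁ ≡row = inj₂ (here (trans q≡ ≡row))
  ...   | inj₂ ≡p   = inj₁ (trans q≡ ≡p)

-- A graph without vertices has no cutset. The vertex serves as the default in
-- `largestRow-neighbourhood`.
cutset⇒vertex : (G : Graph (Fin n)) {S : Subset n} → Cutset G S → Fin n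
cutset⇒vertex {zero}  G cut = contradiction (λ { (() , _) _ }) cut
cutset⇒vertex {suc n} G cut = zero

-- Independence and cutsets via the adjacency matrix

module _ (G : Graph (Fin n)) where

  matrix : Vec (Subset n) n
  matrix = Vec.tabulate (neighbourhood G)

  toList-matrix : toList matrix ≡ List.map (neighbourhood G) (allFin n)
  toList-matrix = trans (toList-tabulate (neighbourhood G))
    (sym (List.map-tabulate (λ i → i) (neighbourhood G)))
    where
    toList-tabulate : (f : Fin m → X) → toList (Vec.tabulate f) ≡ List.tabulate f
    toList-tabulate {zero}  f = refl
    toList-tabulate {suc m} f = cong (f zero ∷_) (toList-tabulate (f ∘ suc))

  encodeGraph≡code : encodeGraph G ≡ code mat matrix
  encodeGraph≡code = cong (encodeList encodeSubset) (sym toList-matrix)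

  private
    N : Subset n → Subset n
    N = neighbours matrix

  ∈-neighbourhood⁺ : ∀ {u w} → Adj G u w → w ∈ neighbourhood G u
  ∈-neighbourhood⁺ {u} {w} uw = Vec.lookup⇒[]= w _
    (trans (Vec.lookup∘tabulate (adj G u) w) (T⇒≡true uw))
    where
    T⇒≡true : ∀ {b} → T b → b ≡ true
    T⇒≡true {true} _ = refl

  ∈-neighbourhood⁻ : ∀ {u w} → w ∈ neighbourhood G u → Adj G u w
  ∈-neighbourhood⁻ {u} {w} w∈ =
    subst T (sym (trans (sym (Vec.lookup∘tabulate (adj G u) w)) (Vec.[]=⇒lookup w∈))) _

  ∈-neighbours⁺ : ∀ {X u w} → u ∈ X → Adj G u w → w ∈ N X
  ∈-neighbours⁺ {X} {u} {w} u∈X uw = ∈-joinRows⁺ matrix X (inj₂ (u , u∈X ,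
    subst (w ∈_) (sym (Vec.lookup∘tabulate (neighbourhood G) u)) (∈-neighbourhood⁺ uw)))

  ∈-neighbours⁻ : ∀ {X w} → w ∈ N X → ∃[ u ] u ∈ X × Adj G u w
  ∈-neighbours⁻ {X} {w} w∈ with ∈-joinRows⁻ matrix X w∈
  ... | inj₁ w∈∅ = contradiction w∈∅ ∉⊥
  ... | inj₂ (u , u∈X , w∈u) =
    u , u∈X , ∈-neighbourhood⁻ (subst (w ∈_) (Vec.lookup∘tabulate (neighbourhood G) u) w∈u)

  independent-reflects : ∀ S → Reflects (Independent G S) (not (inhabited (N S ∩ S)))
  independent-reflects S = reflects-map
    (λ empty u∈S v∈S uv → empty (_ , x∈p∩q⁺ (∈-neighbours⁺ u∈S uv , v∈S)))
    (λ indep (w , w∈) → let (w∈N , w∈S) = x∈p∩q⁻ (N S) S w∈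
                            (u , u∈S , uw) = ∈-neighbours⁻ w∈N in indep u∈S w∈S uw)
    (¬-reflects (inhabited-reflects (N S ∩ S)))

  -- The common invariant of walks in `G - S` and of the search: both step only to neighbours
  -- outside `S`.
  ClosedOutside : Subset n → (Fin n → Set) → Set
  ClosedOutside S P = ∀ {u w} → P u → Adj G u w → w ∉ S → P w

  Vertex : Subset n → Set
  Vertex S = [ v ∈ Fin n ∣ v ∉ S ]

  -- The proof inside a refinement is irrelevant, but a negation can be recomputed from it.
  ∉S : ∀ {S} (a : Vertex S) → value a ∉ S
  ∉S (_ , [ v∉S ]) = ¬-recompute v∉S

  walk-closed : ∀ {S P} → ClosedOutside S P → {a b : Vertex S} →
                Star (Adj (G - S)) a b → P (value a) → P (value b)
  walk-closed closed ε                     Pa = Pa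
  walk-closed closed (_◅_ {j = c} step walk) Pa = walk-closed closed walk (closed Pa step (∉S c))

  module _ (S : Subset n) where

    grow-inflationary : ∀ R → R ⊆ grow matrix S R
    grow-inflationary R = p⊆p∪q _

    reach-⊇ : ∀ R → R ⊆ reach matrix S R
    reach-⊇ R = fold-⊇ (grow matrix S) grow-inflationary R n

    reach-closed : ∀ R → ClosedOutside S (_∈ reach matrix S R)
    reach-closed R u∈ uw w∉S = fold-stable (grow matrix S) grow-inflationary R
      (x∈p∪q⁺ (inj₂ (x∈p∩q⁺ (∈-neighbours⁺ u∈ uw , x∉p⇒x∈∁p w∉S))))

    reach-least : ∀ {R P} → ClosedOutside S P → (∀ {u} → u ∈ R → P u) →
                  ∀ {w} → w ∈ reach matrix S R → P w
    reach-least {R} {P} closed R⊆P = go n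
      where
      go : ∀ j {w} → w ∈ fold R (grow matrix S) j → P w
      go zero    w∈ = R⊆P w∈
      go (suc j) w∈ with x∈p∪q⁻ (fold R (grow matrix S) j) _ w∈
      ... | inj₁ w∈fold = go j w∈fold
      ... | inj₂ w∈∩ with x∈p∩q⁻ (N (fold R (grow matrix S) j)) (∁ S) w∈∩
      ...   | w∈N , w∈∁S with ∈-neighbours⁻ w∈N
      ...     | u , u∈ , uw = closed (go j u∈) uw (x∈∁p⇒x∉p w∈∁S)

    Reachable : Vertex S → Fin n → Set
    Reachable a w = Σ[ w∉S ∈ w ∉ S ] Star (Adj (G - S)) a (w , [ w∉S ])

    reachable : ∀ {s w} (s∉S : s ∉ S) → w ∈ reach matrix S ⁅ s ⁆ → Reachable (s , [ s∉S ]) w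
    reachable {s} s∉S = reach-least
      (λ (_ , walk) uw w∉S → w∉S , walk ◅◅ uw ◅ ε)
      (λ u∈ → subst (Reachable (s , [ s∉S ])) (sym (x∈⁅y⁆⇒x≡y s u∈)) (s∉S , ε))

    connected : ∀ s → s ∉ S → (∀ {w} → w ∉ S → w ∈ reach matrix S ⁅ s ⁆) → Connected (G - S)
    connected s s∉S all u v =
      reverse (symmetric G) (proj₂ (reachable s∉S (all (∉S u)))) ◅◅ proj₂ (reachable s∉S (all (∉S v)))

    unreached : Subset n → Subset n
    unreached R = ∁ (S ∪ reach matrix S R)

    ∈-unreached⁻ : ∀ {R w} → w ∈ unreached R → w ∉ S × w ∉ reach matrix S R
    ∈-unreached⁻ w∈ = (λ w∈S → x∈∁p⇒x∉p w∈ (x∈p∪q⁺ (inj₁ w∈S)))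
                    , (λ w∈R → x∈∁p⇒x∉p w∈ (x∈p∪q⁺ (inj₂ w∈R)))

    ∉-unreached : ∀ {R w} → w ∉ unreached R → w ∉ S → w ∈ reach matrix S R
    ∉-unreached w∉ w∉S with x∈p∪q⁻ S _ (x∉∁p⇒x∈p w∉)
    ... | inj₁ w∈S = contradiction w∈S w∉S
    ... | inj₂ w∈R = w∈R

    -- As a negation, `Cutset` does not hand over two separated vertices. An unreached vertex is
    -- found because nonemptiness of a subset is decidable.
    disconnected-unreached : ∀ {s} → s ∉ S → Cutset G S → Nonempty (unreached ⁅ s ⁆)
    disconnected-unreached {s} s∉S cut = decidable-stable (nonempty? _) λ empty →
      cut (connected s s∉S λ w∉S → ∉-unreached (λ w∈ → empty (_ , w∈)) w∉S)

    cutset-reflects : Reflects (Cutset G S) (inhabited (unreached (firstOutside S false)))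
    cutset-reflects with firstOutside-⁅⁆ S
    -- The reached set contains `s` and is closed under walks, so no walk leads from `s` to an
    -- unreached vertex.
    ... | inj₁ (s , s∉S , eq) rewrite eq = reflects-map
          (λ (w , w∈) conn → let (w∉S , w∉R) = ∈-unreached⁻ w∈ in
            w∉R (walk-closed (reach-closed ⁅ s ⁆) (conn (s , [ s∉S ]) (w , [ w∉S ]))
                  (reach-⊇ ⁅ s ⁆ (x∈⁅x⁆ s))))
          (disconnected-unreached s∉S)
          (inhabited-reflects (unreached ⁅ s ⁆))
    -- With no vertex outside `S`, both sides are false.
    ... | inj₂ full = reflects-map
          (λ (w , w∈) → contradiction (full w) (proj₁ (∈-unreached⁻ w∈)))
          (λ cut → contradiction (λ u v → contradiction (full (value u)) (∉S u)) cut)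
          (inhabited-reflects (unreached (firstOutside S false)))

  -- Independent cutsets among the candidates and their boundaries

  IndependentCutset : Subset n → Set
  IndependentCutset S = Cutset G S × Independent G S

  isIndependentCutset-reflects : ∀ S → Reflects (IndependentCutset S) (isIndependentCutset matrix S)
  isIndependentCutset-reflects S = reflects-map {Independent G S × Cutset G S} swap swap
    (independent-reflects S ×-reflects cutset-reflects S)

  succeeds-reflects : ∀ X →
    Reflects (IndependentCutset X ⊎ IndependentCutset (boundary matrix X)) (succeeds matrix X)
  succeeds-reflects X =
    isIndependentCutset-reflects X ⊎-reflects isIndependentCutset-reflects (boundary matrix X)

  -- Once the boundary is deleted, no edge leaves `X`, so no walk leads from `b` to `v`. The vertex
  -- `v` survives the deletion because the boundary lies in `S`.
  boundary-cutset : ∀ {X S b v} → b ∈ X → v ∉ X → v ∉ S → boundary matrix X ⊆ S →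
                    Cutset G (boundary matrix X)
  boundary-cutset {X} {S} {b} {v} b∈X v∉X v∉S ∂X⊆S conn =
    v∉X (walk-closed closed (conn (b , [ b∉∂X ]) (v , [ v∉S ∘ ∂X⊆S ])) b∈X)
    where
    b∉∂X : b ∉ boundary matrix X
    b∉∂X b∈∂X = x∈∁p⇒x∉p (proj₂ (x∈p∩q⁻ (N X) (∁ X) b∈∂X)) b∈X

    closed : ClosedOutside (boundary matrix X) (_∈ X)
    closed {u} {w} u∈X uw w∉∂X = decidable-stable (w ∈? X) λ w∉X →
      w∉∂X (x∈p∩q⁺ (∈-neighbours⁺ u∈X uw , x∉p⇒x∈∁p w∉X))

  -- If v ∈ S, then S itself is disjoint from the neighbourhood of v, because
  -- it is independent. Otherwise the set X of vertices that v does not reach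
  -- in G - S is disjoint from it, and the boundary of X is a subset of S
  -- which separates X from v.

  exists-successful : ∀ {S} → IndependentCutset S → ∀ v →
    ∃[ X ] (∀ {x} → x ∈ X → ¬ Adj G v x)
         × (IndependentCutset X ⊎ IndependentCutset (boundary matrix X))
  exists-successful {S} (cut , indep) v with v ∈? S
  ... | yes v∈S = S , indep v∈S , inj₁ (cut , indep)
  ... | no  v∉S with disconnected-unreached S v∉S cut
  ...   | b , b∈U = U , U∩Nv≡∅ , inj₂
          ( boundary-cutset b∈U v∉U v∉S ∂U⊆S
          , λ u∈ w∈ → indep (∂U⊆S u∈) (∂U⊆S w∈))
    where
    U : Subset n
    U = unreached S ⁅ v ⁆

    v∈reach : v ∈ reach matrix S ⁅ v ⁆
    v∈reach = reach-⊇ S ⁅ v ⁆ (x∈⁅x⁆ v)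

    v∉U : v ∉ U
    v∉U v∈U = proj₂ (∈-unreached⁻ S v∈U) v∈reach

    U∩Nv≡∅ : ∀ {x} → x ∈ U → ¬ Adj G v x
    U∩Nv≡∅ x∈U vx = let (x∉S , x∉R) = ∈-unreached⁻ S x∈U in
      x∉R (reach-closed S ⁅ v ⁆ v∈reach vx x∉S)

    -- A boundary vertex outside `S` would be reached from `v`, and then so would its neighbour in
    -- `U`.
    ∂U⊆S : boundary matrix U ⊆ S
    ∂U⊆S {w} w∈∂U = decidable-stable (w ∈? S) λ w∉S →
      let (w∈N , w∈∁U)     = x∈p∩q⁻ (N U) (∁ U) w∈∂U
          (u , u∈U , uw)   = ∈-neighbours⁻ w∈N
          (u∉S , u∉R)      = ∈-unreached⁻ S u∈U
          w∈R              = ∉-unreached S (x∈∁p⇒x∉p w∈∁U) w∉S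
      in u∉R (reach-closed S ⁅ v ⁆ w∈R (symmetric G uw) u∉S)

  -- An inclusion is claimed instead of an equality, so that any vertex will do when the fold
  -- returns its initial value `∅`.
  largestRow-neighbourhood : Fin n →
    ∃[ v ] ∀ {x} → x ∈ largestRow (toList matrix) → Adj G v x
  largestRow-neighbourhood v₀ with largestRow-sel (toList matrix)
  ... | inj₁ ≡∅ = v₀ , λ x∈ → contradiction (subst (_ ∈_) ≡∅ x∈) ∉⊥
  ... | inj₂ best∈ with ∈-map⁻ (neighbourhood G)
                        (subst (largestRow (toList matrix) ∈ₗ_) toList-matrix best∈)
  ...   | v , _ , ≡Nv = v , λ x∈ → ∈-neighbourhood⁻ (subst (_ ∈_) ≡Nv x∈)

  maxDegree≤ : maxDegree G ≤ ∣ largestRow (toList matrix) ∣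
  maxDegree≤ = max≤v⁺ z≤n (All.map⁺ (All.map⁻
    (subst (All _) toList-matrix (largestRow-largest (toList matrix)))))

  solve-any : solve matrix ≡ any (succeeds matrix) (candidates (largestRow (toList matrix)))
  solve-any = foldl-∨ false (candidates (largestRow (toList matrix)))
    where
    foldl-∨ : ∀ b Xs → foldl (λ b X → b ∨ succeeds matrix X) b Xs ≡ b ∨ any (succeeds matrix) Xs
    foldl-∨ b []       = sym (Bool.∨-identityʳ b)
    foldl-∨ b (X ∷ Xs) = trans (foldl-∨ _ Xs) (Bool.∨-assoc b (succeeds matrix X) _)

  solve-reflects : Reflects (HasIndependentCutset G) (solve matrix)
  solve-reflects = fromEquivalence sound complete
    where
    best : Subset n
    best = largestRow (toList matrix)

    sound : T (solve matrix) → HasIndependentCutset G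
    sound t with find (any⁻ (succeeds matrix) (candidates best) (subst T solve-any t))
    ... | X , _ , success with reflects-sound (succeeds-reflects X) success
    ...   | inj₁ ic = X , ic
    ...   | inj₂ ic = boundary matrix X , ic

    complete : HasIndependentCutset G → T (solve matrix)
    complete (S , ic) with largestRow-neighbourhood (cutset⇒vertex G (proj₁ ic))
    ... | v , best⊆Nv with exists-successful ic v
    ...   | X , X∩Nv≡∅ , success = subst T (sym solve-any)
      (any⁺ (succeeds matrix) (lose
        (∈-candidates best X λ x∈X x∈best → X∩Nv≡∅ x∈X (best⊆Nv x∈best))
        (reflects-complete (succeeds-reflects X) success)))

-- Input size, positivity of `f`, and the final bound

size-encodeList : (enc : X → Tree) (xs : List X) → length xs < size (encodeList enc xs)
size-encodeList enc []       = s≤s z≤n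
size-encodeList enc (x ∷ xs) = s≤s (≤-trans (size-encodeList enc xs) (m≤n+m _ _))

-- Being strict, it bounds the base `suc n` of `Polynomial` by the input size.
n<size-encodeGraph : (G : Graph (Fin n)) → n < size (encodeGraph G)
n<size-encodeGraph {n} G = subst (_< size (encodeGraph G))
  (trans (List.length-map (neighbourhood G) (allFin n)) (List.length-tabulate (λ i → i)))
  (size-encodeList encodeSubset (List.map (neighbourhood G) (allFin n)))

time>0 : p $ x ⇓ y in-time t → t > 0
time>0 skip               = s≤s z≤n
time>0 null               = s≤s z≤n
time>0 hd-nil             = s≤s z≤n
time>0 hd-∙               = s≤s z≤n
time>0 tl-nil             = s≤s z≤n
time>0 tl-∙               = s≤s z≤n
time>0 (cons _ _)         = s≤s z≤n
time>0 (_ ⨾ _)            = s≤s z≤n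
time>0 (if-then _ _)      = s≤s z≤n
time>0 (if-else _ _)      = s≤s z≤n
time>0 (while-stop _)     = s≤s z≤n
time>0 (while-step _ _ _) = s≤s z≤n

edgeless : ∀ n → Graph (Fin n)
edgeless n = record { adj = λ _ _ → false ; symmetric = λ () ; loopless = λ () }

-- If `f n` were 0, the time bound would vanish on every graph with `n` vertices; the edgeless one
-- is an instance on which the run takes at least one step.
enumeration-time>0 : (f : ℕ → ℕ) {A : Program} →
  A solves ENUMERATE-MAXIMAL-INDEPENDENT-SETS in-O* (λ (n , G) → f n) → ∀ n → f n > 0
enumeration-time>0 f (c , d , solves) n = n≢0⇒n>0 λ fn≡0 →
  let (_ , t , run , _ , t≤) = solves (n , edgeless n)
  in <⇒≱ (time>0 run) (subst (t ≤_) (trans (cong (c * size (encodeGraph (edgeless n)) ^ d *_) fn≡0)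
                                            (*-zeroʳ (c * size (encodeGraph (edgeless n)) ^ d))) t≤)

theorem4p1 : (f : ℕ → ℕ) (A : Program) →
    A solves ENUMERATE-MAXIMAL-INDEPENDENT-SETS in-O* (λ (n , G) → f n) →
    ∃[ B ] B solves INDEPENDENT-CUTSET in-O*
    (λ (n , G , _) → let k = n ∸ maxDegree G in 2 ^ k * f k)
theorem4p1 f A A-solves = solver , c , d , λ (n , G , _) → correct n G
  where
  c d : ℕ
  c = proj₁ solveTime-polynomial
  d = proj₁ (proj₂ solveTime-polynomial)

  answer : ∀ {P : Set} {b} → Reflects P b →
           (encodeBool b ≡ encodeBool true × P) ⊎ (encodeBool b ≡ encodeBool false × ¬ P)
  answer (ofʸ p)  = inj₁ (refl , p)
  answer (ofⁿ ¬p) = inj₂ (refl , ¬p)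

  correct : ∀ n (G : Graph (Fin n)) → let k = n ∸ maxDegree G in
    ∃[ y ] ∃[ t ] (solver $ encodeGraph G ⇓ y in-time t)
                × ((y ≡ encodeBool true × HasIndependentCutset G) ⊎
                   (y ≡ encodeBool false × ¬ HasIndependentCutset G))
                × t ≤ c * size (encodeGraph G) ^ d * (2 ^ k * f k)
  correct n G =
    let (t , run , t≤) = run-solver n (matrix G)
    in encodeBool (solve (matrix G)) , t
       , subst (solver $_⇓ encodeBool (solve (matrix G)) in-time t) (sym (encodeGraph≡code G)) run
       , answer (solve-reflects G) , ≤-trans t≤ bound
    where
    k : ℕ
    k = n ∸ maxDegree G

    best : Subset n
    best = largestRow (toList (matrix G))

    ∣∁best∣≤k : ∣ ∁ best ∣ ≤ k
    ∣∁best∣≤k = ≤-trans (≤-reflexive (∣∁p∣≡n∸∣p∣ best)) (∸-monoʳ-≤ n (maxDegree≤ G))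

    -- The polynomial in `n` becomes one in the input size, the exponent grows to `k`, and the
    -- factor `f k` can be inserted because it is at least 1.
    bound : solveTime n * 2 ^ ∣ ∁ best ∣ ≤ c * size (encodeGraph G) ^ d * (2 ^ k * f k)
    bound = *-mono-≤
      (≤-trans (proj₂ (proj₂ solveTime-polynomial) n)
        (*-monoʳ-≤ c (^-monoˡ-≤ d (n<size-encodeGraph G))))
      (≤-trans (^-monoʳ-≤ 2 ∣∁best∣≤k)
        (m≤m*n (2 ^ k) (f k) {{>-nonZero (enumeration-time>0 f {A} A-solves k)}}))
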